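{- Computability is not stable over the structure $\langle\mathbb{N}\rangle$ (the set of natural numbers with no operations).
   Context: Computability over natural numbers is the usual one. A set $A \subseteq \mathbb{N}$ is effectively enumerable if it is empty or the image of a total computable function from $\mathbb{N}$ to $\mathbb{N}$. For $A \subseteq \mathbb{N}^m$ and $B \subseteq \mathbb{N}$, a computable function from $A$ to $B$ is a partial computable function that is defined at every element of $A$ and takes values in $B$ there. Indexing: an indexing of a set $E$ is a partial function $i$ from $\mathbb{N}$ to $E$ such that $dom(i)$ is effectively enumerable, $i$ is surjective, and there is a computable function $eq$ from $dom(i)\times dom(i)$ to $\{0,1\}$ with $eq(x,y)=1$ if $i(x)=i(y)$ and $eq(x,y)=0$ otherwise. An indexing $i$ of the set $E$ is an admissible indexing of a one-sorted structure $\langle E,op_1,\ldots,op_p\rangle$ if every operation $op: E^m\to E$ among $op_1,\ldots,op_p$ is computable relatively to $i$, that is, there is a computable function $\hat{op}$ from $dom(i)^m$ to $dom(i)$ such that $i(\hat{op}(x_1,\ldots,x_m)) = op(i(x_1),\ldots,i(x_m))$ for all $x_1,\ldots,x_m\in dom(i)$. When there are no operations, every indexing is admissible. Computability is stable over $\langle E,op_1,\ldots,op_p\rangle$ if there exists an admissible indexing of this structure and, for all admissible indexings $j$ and $j'$ of it, there exists a computable function $h$ from $dom(j')$ to $dom(j)$ such that $j' = j\circ h$. -}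

module Defs where

open import Data.Fin.Base using (Fin)
open import Data.Nat.Base using (ℕ; zero; suc; _<_)
open import Data.Product using (_×_; Σ-syntax; ∃-syntax)
open import Data.Sum.Base using (_⊎_)
open import Data.Vec.Base using (Vec; []; _∷_; [_]; lookup)
open import Data.Vec.Relation.Unary.All using (All)
open import Data.Vec.Relation.Binary.Pointwise.Inductive using (Pointwise)
open import Function.Bundles using (_⇔_)
open import Level using (0ℓ)
open import Relation.Binary.PropositionalEquality using (_≡_; _≢_)
open import Relation.Unary using (Pred; _∈_; Empty; _∪_; _≐_; ｛_｝; U)

-- Kleene's partial recursive functions, by their defining schemes.

data PR : ℕ → Set where
  Zero : ∀ {n} → PR n
  Succ : PR 1
  Proj : ∀ {n} → Fin n → PR n
  Comp : ∀ {m n} → PR m → Vec (PR n) m → PR n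
  Rec  : ∀ {n} → PR n → PR (suc (suc n)) → PR (suc n)
  Min  : ∀ {n} → PR (suc n) → PR n

-- p ⟨ xs ⟩⇓ y : the partial function denoted by p is defined at xs, with
-- value y.  Recursion and minimisation act on the first argument; the step of
-- a recursion receives the counter, then the previous value, then the
-- parameters.

infix 4 _⟨_⟩⇓_

data _⟨_⟩⇓_ : ∀ {n} → PR n → Vec ℕ n → ℕ → Set where
  ⇓Zero : ∀ {n} {xs : Vec ℕ n} → Zero ⟨ xs ⟩⇓ 0
  ⇓Succ : ∀ {x} → Succ ⟨ [ x ] ⟩⇓ suc x
  ⇓Proj : ∀ {n} {xs : Vec ℕ n} (k : Fin n) → Proj k ⟨ xs ⟩⇓ lookup xs k
  ⇓Comp : ∀ {m n} {f : PR m} {gs : Vec (PR n) m} {xs ys z} →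
          Pointwise (λ g y → g ⟨ xs ⟩⇓ y) gs ys →
          f ⟨ ys ⟩⇓ z →
          Comp f gs ⟨ xs ⟩⇓ z
  ⇓Rec₀ : ∀ {n} {f : PR n} {g xs y} →
          f ⟨ xs ⟩⇓ y →
          Rec f g ⟨ zero ∷ xs ⟩⇓ y
  ⇓Rec₊ : ∀ {n} {f : PR n} {g k xs y z} →
          Rec f g ⟨ k ∷ xs ⟩⇓ y →
          g ⟨ k ∷ y ∷ xs ⟩⇓ z →
          Rec f g ⟨ suc k ∷ xs ⟩⇓ z
  ⇓Min  : ∀ {n} {f : PR (suc n)} {k xs} →
          (∀ {l} → l < k → ∃[ y ] (f ⟨ l ∷ xs ⟩⇓ suc y)) →
          f ⟨ k ∷ xs ⟩⇓ 0 →
          Min f ⟨ xs ⟩⇓ k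

_^_ : Pred ℕ 0ℓ → (m : ℕ) → Pred (Vec ℕ m) 0ℓ
A ^ m = All A

-- A partial computable function defined at every element of A (and possibly
-- elsewhere), with values in B on A.

record ComputableFunction {m : ℕ} (A : Pred (Vec ℕ m) 0ℓ) (B : Pred ℕ 0ℓ) : Set where
  field
    program : PR m
    defined : ∀ {xs} → xs ∈ A → ∃[ y ] (program ⟨ xs ⟩⇓ y × y ∈ B)

open ComputableFunction public

image : {A B : Pred ℕ 0ℓ} → ComputableFunction (A ^ 1) B → Pred ℕ 0ℓ
image {A} f y = ∃[ x ] (x ∈ A × program f ⟨ [ x ] ⟩⇓ y)

EffectivelyEnumerable : Pred ℕ 0ℓ → Set
EffectivelyEnumerable A =
  Empty A ⊎ (Σ[ f ∈ ComputableFunction (U ^ 1) U ] (A ≐ image f))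

-- A single-valued graph, rather than a function ℕ → Maybe E, which would make
-- the domain decidable.

record PartialFunction (E : Set) : Set₁ where
  field
    _↦_          : ℕ → E → Set
    singleValued : ∀ {x a b} → x ↦ a → x ↦ b → a ≡ b

_∋_↦_ : {E : Set} → PartialFunction E → ℕ → E → Set
i ∋ x ↦ e = PartialFunction._↦_ i x e

infix 4 _∋_↦_

dom : {E : Set} → PartialFunction E → Pred ℕ 0ℓ
dom i x = ∃[ e ] (i ∋ x ↦ e)

DecidesEquality : {E : Set} (i : PartialFunction E) →
                  ComputableFunction (dom i ^ 2) (｛ 0 ｝ ∪ ｛ 1 ｝) → Set
DecidesEquality i eq = ∀ {x y a b} → i ∋ x ↦ a → i ∋ y ↦ b →
  (a ≡ b → program eq ⟨ x ∷ y ∷ [] ⟩⇓ 1) ×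
  (a ≢ b → program eq ⟨ x ∷ y ∷ [] ⟩⇓ 0)

record IsIndexing {E : Set} (i : PartialFunction E) : Set where
  field
    domain-enumerable : EffectivelyEnumerable (dom i)
    surjective        : ∀ e → ∃[ x ] (i ∋ x ↦ e)
    equality          : Σ[ eq ∈ ComputableFunction (dom i ^ 2) (｛ 0 ｝ ∪ ｛ 1 ｝) ]
                          DecidesEquality i eq

record Structure : Set₁ where
  field
    Carrier   : Set
    opCount   : ℕ
    arity     : Fin opCount → ℕ
    operation : (k : Fin opCount) → Vec Carrier (arity k) → Carrier

ComputableRelativeTo : {E : Set} {m : ℕ} → PartialFunction E → (Vec E m → E) → Set
ComputableRelativeTo {m = m} i op =
  Σ[ ôp ∈ ComputableFunction (dom i ^ m) (dom i) ]
    (∀ {xs es y} → Pointwise (i ∋_↦_) xs es → program ôp ⟨ xs ⟩⇓ y → i ∋ y ↦ op es)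

record IsAdmissibleIndexing (S : Structure) (i : PartialFunction (Structure.Carrier S)) : Set where
  open Structure S
  field
    isIndexing            : IsIndexing i
    operations-computable : ∀ k → ComputableRelativeTo i (operation k)

-- j′ = j ∘ h, where h is regarded as a function on dom j′ only.

_≗_∘_ : {E : Set} (j′ j : PartialFunction E) →
        ComputableFunction (dom j′ ^ 1) (dom j) → Set
j′ ≗ j ∘ h = ∀ {x} → x ∈ dom j′ → ∀ e →
  (j′ ∋ x ↦ e) ⇔ (∃[ z ] (program h ⟨ [ x ] ⟩⇓ z × j ∋ z ↦ e))

ComputabilityStableOver : Structure → Set₁
ComputabilityStableOver S =
  (∃[ i ] IsAdmissibleIndexing S i) ×
  (∀ j j′ → IsAdmissibleIndexing S j → IsAdmissibleIndexing S j′ →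
    Σ[ h ∈ ComputableFunction (dom j′ ^ 1) (dom j) ] (j′ ≗ j ∘ h))

⟨ℕ⟩ : Structure
⟨ℕ⟩ = record
  { Carrier   = ℕ
  ; opCount   = 0
  ; arity     = λ ()
  ; operation = λ ()
  }

{-# OPTIONS --safe #-}

-- The identity is an indexing of ℕ, and so is every permutation σ, since a
-- permutation reduces σ x ≡ σ y to x ≡ y.  Stability would therefore make every
-- permutation computable.  But fix an injective numbering of programs and let σ
-- exchange 2c and 2c + 1 exactly when the program numbered c maps 2c to itself:
-- the program numbered c disagrees with σ at 2c.

module Submission where

open import Defs
open import Axiom.ExcludedMiddle using (ExcludedMiddle)
open import Level using (0ℓ)
open import Relation.Nullary using (¬_; yes; no; does; contradiction)

open import Data.Bool.Base using (Bool; true; false; if_then_else_)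
open import Data.Fin.Base using (zero; suc; toℕ)
open import Data.Fin.Properties using (toℕ-injective)
open import Data.Nat.Base using (ℕ; zero; suc; pred; _+_; _∸_)
open import Data.Nat.Properties
  using (suc-injective; 1+n≢n; _≟_; n∸n≡0; m∸n≡0⇒m≤n; ≤-antisym; pred[m∸n]≡m∸[1+n])
open import Data.Product using (_×_; _,_; ∃-syntax)
open import Data.Sum.Base using (inj₁; inj₂)
open import Data.Unit.Base using (tt)
open import Data.Vec.Base using (Vec; []; _∷_; [_])
open import Data.Vec.Relation.Binary.Pointwise.Inductive using ([]; _∷_)
open import Data.Vec.Relation.Unary.All using ([]; _∷_)
open import Function.Base using (_∘_; id)
open import Function.Bundles using (Equivalence)
open import Function.Definitions using (Injective)
open import Relation.Binary.PropositionalEquality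
  using (_≡_; _≢_; refl; sym; trans; cong; cong₂; subst)

double : ℕ → ℕ
double zero    = zero
double (suc n) = suc (suc (double n))

double-injective : ∀ {m n} → double m ≡ double n → m ≡ n
double-injective {zero}  {zero}  _  = refl
double-injective {suc m} {suc n} eq =
  cong suc (double-injective (suc-injective (suc-injective eq)))

double≢1+double : ∀ m n → double m ≢ suc (double n)
double≢1+double (suc m) zero    ()
double≢1+double (suc m) (suc n) eq =
  double≢1+double m n (suc-injective (suc-injective eq))

-- pair a b = 2ᵃ (2b + 1)
pair : ℕ → ℕ → ℕ
pair zero    b = suc (double b)
pair (suc a) b = double (pair a b)

pair-injective : ∀ {a b c d} → pair a b ≡ pair c d → a ≡ c × b ≡ d
pair-injective {zero}  {b} {zero}  {d} eq = refl , double-injective (suc-injective eq)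
pair-injective {zero}  {b} {suc c} {d} eq = contradiction (sym eq) (double≢1+double (pair c d) b)
pair-injective {suc a} {b} {zero}  {d} eq = contradiction eq (double≢1+double (pair a b) d)
pair-injective {suc a} {b} {suc c} {d} eq with pair-injective {a} {b} {c} {d} (double-injective eq)
... | refl , b≡d = refl , b≡d

tag : ∀ {n} → PR n → ℕ
tag Zero       = 0
tag Succ       = 1
tag (Proj _)   = 2
tag (Comp _ _) = 3
tag (Rec _ _)  = 4
tag (Min _)    = 5

code  : ∀ {n} → PR n → ℕ
body  : ∀ {n} → PR n → ℕ
codes : ∀ {m n} → Vec (PR n) m → ℕ

code p = pair (tag p) (body p)

body Zero                = 0
body Succ                = 0
body (Proj k)            = toℕ k
body (Comp {m = m} f gs) = pair m (pair (code f) (codes gs))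
body (Rec f g)           = pair (code f) (code g)
body (Min f)             = code f

codes []       = 0
codes (g ∷ gs) = pair (code g) (codes gs)

code-injective     : ∀ {n} (p q : PR n) → code p ≡ code q → p ≡ q
tag-body-injective : ∀ {n} (p q : PR n) → tag p ≡ tag q → body p ≡ body q → p ≡ q
codes-injective    : ∀ {m n} (ps qs : Vec (PR n) m) → codes ps ≡ codes qs → ps ≡ qs

code-injective p q eq with pair-injective {tag p} {_} {tag q} eq
... | tag≡ , body≡ = tag-body-injective p q tag≡ body≡

tag-body-injective Zero     Zero      _ _  = refl
tag-body-injective Succ     Succ      _ _  = refl
tag-body-injective (Proj k) (Proj l)  _ eq = cong Proj (toℕ-injective eq)
tag-body-injective (Comp {m = m} f gs) (Comp {m = m′} f′ gs′) _ eq
  with pair-injective {m} {_} {m′} eq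
... | refl , eq′ with pair-injective {code f} {_} {code f′} eq′
... | f≡ , gs≡ = cong₂ Comp (code-injective f f′ f≡) (codes-injective gs gs′ gs≡)
tag-body-injective (Rec f g) (Rec f′ g′) _ eq with pair-injective {code f} {_} {code f′} eq
... | f≡ , g≡ = cong₂ Rec (code-injective f f′ f≡) (code-injective g g′ g≡)
tag-body-injective (Min f) (Min f′) _ eq = cong Min (code-injective f f′ eq)

codes-injective []       []       _  = refl
codes-injective (p ∷ ps) (q ∷ qs) eq with pair-injective {code p} {_} {code q} eq
... | p≡ , ps≡ = cong₂ _∷_ (code-injective p q p≡) (codes-injective ps qs ps≡)

predᴾ : PR 1
predᴾ = Rec Zero (Proj zero)

predᴾ-correct : ∀ n → predᴾ ⟨ [ n ] ⟩⇓ pred n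
predᴾ-correct zero    = ⇓Rec₀ ⇓Zero
predᴾ-correct (suc n) = ⇓Rec₊ (predᴾ-correct n) (⇓Proj zero)

-- The subtrahend is the first argument, because Rec recurses on it.
monusᴾ : PR 2
monusᴾ = Rec (Proj zero) (Comp predᴾ [ Proj (suc zero) ])

monusᴾ-correct : ∀ m n → monusᴾ ⟨ n ∷ m ∷ [] ⟩⇓ m ∸ n
monusᴾ-correct m zero    = ⇓Rec₀ (⇓Proj zero)
monusᴾ-correct m (suc n) =
  subst (monusᴾ ⟨ suc n ∷ m ∷ [] ⟩⇓_) (pred[m∸n]≡m∸[1+n] m n)
    (⇓Rec₊ (monusᴾ-correct m n)
           (⇓Comp (⇓Proj (suc zero) ∷ []) (predᴾ-correct (m ∸ n))))

isZeroᴾ : PR 1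
isZeroᴾ = Rec (Comp Succ [ Zero ]) Zero

isZeroᴾ-zero : isZeroᴾ ⟨ [ 0 ] ⟩⇓ 1
isZeroᴾ-zero = ⇓Rec₀ (⇓Comp (⇓Zero ∷ []) ⇓Succ)

isZeroᴾ-suc : ∀ n → isZeroᴾ ⟨ [ suc n ] ⟩⇓ 0
isZeroᴾ-suc zero    = ⇓Rec₊ isZeroᴾ-zero ⇓Zero
isZeroᴾ-suc (suc n) = ⇓Rec₊ (isZeroᴾ-suc n) ⇓Zero

bothZeroᴾ : PR 2
bothZeroᴾ = Rec isZeroᴾ Zero

bothZeroᴾ-zero : bothZeroᴾ ⟨ 0 ∷ 0 ∷ [] ⟩⇓ 1
bothZeroᴾ-zero = ⇓Rec₀ isZeroᴾ-zero

bothZeroᴾ-nonzero : ∀ a b → ¬ (a ≡ 0 × b ≡ 0) → bothZeroᴾ ⟨ a ∷ b ∷ [] ⟩⇓ 0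
bothZeroᴾ-nonzero zero          zero    ¬0 = contradiction (refl , refl) ¬0
bothZeroᴾ-nonzero zero          (suc b) _  = ⇓Rec₀ (isZeroᴾ-suc b)
bothZeroᴾ-nonzero (suc zero)    zero    _  = ⇓Rec₊ bothZeroᴾ-zero ⇓Zero
bothZeroᴾ-nonzero (suc zero)    (suc b) _  = ⇓Rec₊ (⇓Rec₀ (isZeroᴾ-suc b)) ⇓Zero
bothZeroᴾ-nonzero (suc (suc a)) b       _  = ⇓Rec₊ (bothZeroᴾ-nonzero (suc a) b λ ()) ⇓Zero

equalᴾ : PR 2
equalᴾ = Comp bothZeroᴾ
  ( Comp monusᴾ (Proj (suc zero) ∷ Proj zero ∷ [])
  ∷ Comp monusᴾ (Proj zero ∷ Proj (suc zero) ∷ [])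
  ∷ [])

equalᴾ-from-differences : ∀ x y {z} → bothZeroᴾ ⟨ x ∸ y ∷ y ∸ x ∷ [] ⟩⇓ z →
                          equalᴾ ⟨ x ∷ y ∷ [] ⟩⇓ z
equalᴾ-from-differences x y = ⇓Comp
  ( ⇓Comp (⇓Proj (suc zero) ∷ ⇓Proj zero ∷ []) (monusᴾ-correct x y)
  ∷ ⇓Comp (⇓Proj zero ∷ ⇓Proj (suc zero) ∷ []) (monusᴾ-correct y x)
  ∷ [])

equalᴾ-≡ : ∀ {x y} → x ≡ y → equalᴾ ⟨ x ∷ y ∷ [] ⟩⇓ 1
equalᴾ-≡ {x} refl = equalᴾ-from-differences x x
  (subst (λ d → bothZeroᴾ ⟨ d ∷ d ∷ [] ⟩⇓ 1) (sym (n∸n≡0 x)) bothZeroᴾ-zero)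

equalᴾ-≢ : ∀ {x y} → x ≢ y → equalᴾ ⟨ x ∷ y ∷ [] ⟩⇓ 0
equalᴾ-≢ {x} {y} x≢y = equalᴾ-from-differences x y
  (bothZeroᴾ-nonzero (x ∸ y) (y ∸ x) λ (x∸y≡0 , y∸x≡0) →
    x≢y (≤-antisym (m∸n≡0⇒m≤n x∸y≡0) (m∸n≡0⇒m≤n y∸x≡0)))

graph : {E : Set} → (ℕ → E) → PartialFunction E
graph f = record
  { _↦_          = λ x e → f x ≡ e
  ; singleValued = λ p q → trans (sym p) q
  }

graph-isIndexing : {E : Set} {f : ℕ → E} → Injective _≡_ _≡_ f → (∀ e → ∃[ x ] (f x ≡ e)) →
                   IsIndexing (graph f)
graph-isIndexing {f = f} injective surjective = record
  { domain-enumerable = inj₂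
      ( record { program = Proj zero ; defined = λ _ → _ , ⇓Proj zero , tt }
      , (λ {x} _ → x , tt , ⇓Proj zero)
      , (λ {x} _ → f x , refl))
  ; surjective = surjective
  ; equality =
      record { program = equalᴾ ; defined = λ { {x ∷ y ∷ []} _ → equalᴾ-defined x y } }
      , λ { refl refl → (λ fx≡fy → equalᴾ-≡ (injective fx≡fy))
                      , (λ fx≢fy → equalᴾ-≢ (fx≢fy ∘ cong f)) }
  }
  where
  equalᴾ-defined : ∀ x y → ∃[ z ] (equalᴾ ⟨ x ∷ y ∷ [] ⟩⇓ z × _)
  equalᴾ-defined x y with x ≟ y
  ... | yes x≡y = 1 , equalᴾ-≡ x≡y , inj₂ refl
  ... | no  x≢y = 0 , equalᴾ-≢ x≢y , inj₁ refl

involution-isAdmissible : {f : ℕ → ℕ} → (∀ x → f (f x) ≡ x) →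
                          IsAdmissibleIndexing ⟨ℕ⟩ (graph f)
involution-isAdmissible {f} involutive = record
  { isIndexing = graph-isIndexing
      (λ {x} {y} fx≡fy → trans (sym (involutive x)) (trans (cong f fx≡fy) (involutive y)))
      (λ e → f e , involutive e)
  ; operations-computable = λ ()
  }

swapPairs : (ℕ → Bool) → ℕ → ℕ
swapPairs b zero          = if b 0 then 1 else 0
swapPairs b (suc zero)    = if b 0 then 0 else 1
swapPairs b (suc (suc n)) = suc (suc (swapPairs (b ∘ suc) n))

swapPairs-involutive : ∀ b n → swapPairs b (swapPairs b n) ≡ n
swapPairs-involutive b zero with b 0 in eq
... | true  rewrite eq = refl
... | false rewrite eq = refl
swapPairs-involutive b (suc zero) with b 0 in eq
... | true  rewrite eq = refl
... | false rewrite eq = refl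
swapPairs-involutive b (suc (suc n)) = cong (2 +_) (swapPairs-involutive (b ∘ suc) n)

swapPairs-double : ∀ b n → swapPairs b (double n) ≡ (if b n then suc (double n) else double n)
swapPairs-double b zero    = refl
swapPairs-double b (suc n) rewrite swapPairs-double (b ∘ suc) n with b (suc n)
... | true  = refl
... | false = refl

FixesOwnDouble : ℕ → Set
FixesOwnDouble c = ∃[ p ] (code {1} p ≡ c × p ⟨ [ double c ] ⟩⇓ double c)

module _ (em : ExcludedMiddle 0ℓ) where

  diagonal : ℕ → ℕ
  diagonal = swapPairs (λ c → does (em {FixesOwnDouble c}))

  diagonal-uncomputable : ∀ p → ¬ (∀ x y → (p ⟨ [ x ] ⟩⇓ y → diagonal x ≡ y) ×
                                           (diagonal x ≡ y → p ⟨ [ x ] ⟩⇓ y))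
  diagonal-uncomputable p computes
    with em {FixesOwnDouble (code p)} | swapPairs-double (λ c → does (em {FixesOwnDouble c})) (code p)
       | computes (double (code p)) (double (code p))
  ... | yes (q , q≡p , q⇓) | moved | sound , _ with code-injective q p q≡p
  ...   | refl = contradiction (trans (sym moved) (sound q⇓)) 1+n≢n
  diagonal-uncomputable p computes | no ¬fixes | fixed | _ , complete =
    ¬fixes (p , refl , complete fixed)

proposition8 : ExcludedMiddle 0ℓ → ¬ ComputabilityStableOver ⟨ℕ⟩
proposition8 em (_ , stable)
  with stable (graph id) (graph (diagonal em))
         (involution-isAdmissible λ _ → refl)
         (involution-isAdmissible (swapPairs-involutive _))
... | h , diagonal≗h = diagonal-uncomputable em (program h) λ x y →
  let open Equivalence (diagonal≗h {x} (diagonal em x , refl) y) in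
    (λ ⇓y → from (y , ⇓y , refl))
  , (λ eq → let (z , ⇓z , z≡y) = to eq in subst (program h ⟨ [ x ] ⟩⇓_) z≡y ⇓z)
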